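{- Let $n\ge 3$ and let $BS_n$ be the $n$-dimensional bubble-sort star graph. Then $\mathrm{smp}(BS_n)=2$, and every optimal strong matching preclusion set of $BS_n$ is a set of two vertices from the same bipartition set of $BS_n$.
   Context: For a permutation $v=v_1v_2\cdots v_n$ of $[1,n]=\{1,\dots,n\}$ and distinct $i,j\in[1,n]$, $v\circ\langle i,j\rangle$ denotes the permutation obtained from $v$ by exchanging the entries in positions $i$ and $j$. The $n$-dimensional bubble-sort star graph $BS_n$ ($n\ge 2$) has as vertex set all permutations of $[1,n]$, and two distinct vertices $u,v$ are adjacent iff $u=v\circ\langle 1,i\rangle$ for some $i\in[2,n]$, or $u=v\circ\langle i-1,i\rangle$ for some $i\in[3,n]$. It is a bipartite $(2n-3)$-regular graph on $n!$ vertices. A perfect matching covers every vertex; an almost-perfect matching covers all vertices but one. For $F^*\subseteq V(G)\cup E(G)$, $G-F^*$ is the graph obtained by deleting the vertices in $F^*$ (with their incident edges) and the edges in $F^*$. $F^*$ is a strong matching preclusion set of $G$ if $G-F^*$ has neither a perfect matching nor an almost-perfect matching; $\mathrm{smp}(G)$ is the minimum size of such a set, and a strong matching preclusion set of size $\mathrm{smp}(G)$ is called optimal. -}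

module Defs where

open import Data.Nat using (ℕ; zero; suc; _≤_; _<_)
open import Data.Fin using (Fin; toℕ)
open import Data.Vec using (Vec; lookup; _[_]≔_)
open import Data.List using (List; length)
open import Data.List.Membership.Propositional using (_∈_; _∉_)
open import Data.Product using (Σ; ∃; _×_; _,_)
open import Data.Sum using (_⊎_)
open import Data.Bool using (Bool)
open import Relation.Binary.PropositionalEquality using (_≡_; _≢_)
open import Relation.Nullary using (¬_)
open import Function.Definitions using (Bijective)

-- Positions are 0-indexed: Fin n = {0,…,n-1} stands for [1,n].
-- A vertex of BS_n: an arrangement v = v₁…vₙ of symbols from Fin n
-- (which is a vertex iff it is a permutation, i.e. bijective as a map).
Arr : ℕ → Set
Arr n = Vec (Fin n) n

IsPerm : {n : ℕ} → Arr n → Set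
IsPerm v = Bijective _≡_ _≡_ (lookup v)

swap : {n : ℕ} → Arr n → Fin n → Fin n → Arr n
swap v i j = (v [ i ]≔ lookup v j) [ j ]≔ lookup v i

Adj : {n : ℕ} → Arr n → Arr n → Set
Adj {n} u v =
  (Σ (Fin n) λ i → Σ (Fin n) λ j → toℕ i ≡ 0 × 1 ≤ toℕ j × u ≡ swap v i j)
  ⊎ (Σ (Fin n) λ i → Σ (Fin n) λ j → 1 ≤ toℕ i × toℕ j ≡ suc (toℕ i) × u ≡ swap v i j)

data Elem (n : ℕ) : Set where
  vtx : Arr n → Elem n
  edg : Arr n → Arr n → Elem n

ValidElem : {n : ℕ} → Elem n → Set
ValidElem (vtx v) = IsPerm v
ValidElem (edg u v) = IsPerm u × IsPerm v × Adj u v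

-- F* ⊆ V ∪ E, given as a list of elements (its size is its length)
AllValid : {n : ℕ} → List (Elem n) → Set
AllValid {n} F = (x : Elem n) → x ∈ F → ValidElem x

VertexOf : {n : ℕ} → List (Elem n) → Arr n → Set
VertexOf F w = IsPerm w × vtx w ∉ F

EdgeOf : {n : ℕ} → List (Elem n) → Arr n → Arr n → Set
EdgeOf F u v = VertexOf F u × VertexOf F v × Adj u v
             × edg u v ∉ F × edg v u ∉ F

Incident : {n : ℕ} → Arr n → Arr n × Arr n → Set
Incident w (u , v) = w ≡ u ⊎ w ≡ v

IsMatching : {n : ℕ} → List (Elem n) → List (Arr n × Arr n) → Set
IsMatching {n} F M =
  ((e : Arr n × Arr n) → e ∈ M → EdgeOf F (Data.Product.proj₁ e) (Data.Product.proj₂ e))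
  × ((i j : Fin (length M)) → i ≢ j → (w : Arr n) →
       Incident w (Data.List.lookup M i) → ¬ Incident w (Data.List.lookup M j))

Covers : {n : ℕ} → List (Arr n × Arr n) → Arr n → Set
Covers M w = Σ _ λ e → e ∈ M × Incident w e

HasPerfectMatching : {n : ℕ} → List (Elem n) → Set
HasPerfectMatching {n} F = Σ (List (Arr n × Arr n)) λ M →
  IsMatching F M × ((w : Arr n) → VertexOf F w → Covers M w)

HasAlmostPerfectMatching : {n : ℕ} → List (Elem n) → Set
HasAlmostPerfectMatching {n} F = Σ (List (Arr n × Arr n)) λ M →
  IsMatching F M × Σ (Arr n) λ w₀ → VertexOf F w₀ × ¬ Covers M w₀
  × ((w : Arr n) → VertexOf F w → w ≢ w₀ → Covers M w)

IsSMPSet : {n : ℕ} → List (Elem n) → Set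
IsSMPSet F = AllValid F × ¬ HasPerfectMatching F × ¬ HasAlmostPerfectMatching F

-- u and v lie in the same bipartition set of (the connected bipartite) BS_n:
-- they receive the same colour under every proper 2-colouring
SameSide : {n : ℕ} → Arr n → Arr n → Set
SameSide {n} u v = (c : Arr n → Bool) →
  ((x y : Arr n) → IsPerm x → Adj x y → c x ≢ c y) → c u ≡ c v

{-# OPTIONS --safe #-}

-- The transposition τ of the first two positions gives a perfect matching of BS_n.  Alternating
-- it with the star edges ⟨1,j⟩ moves a vertex along the 3-cycles τ⟨1,j⟩, which generate the
-- alternating group.  Hence from u one reaches either v or τv by such steps: in the first case
-- every proper 2-colouring agrees on u and v, in the second the alternating path turns the
-- matching τ into a perfect matching of BS_n − {u,v}.  Sets F* with at most one vertex are
-- harmless because ⟨1,2⟩, ⟨1,3⟩ and ⟨2,3⟩ give three edge-disjoint perfect matchings, one of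
-- which avoids the edges in F*.  Conversely, if u and v have the same parity, a matching that
-- misses at most one vertex of BS_n − {u,v} would map the odd class injectively into itself
-- without being onto.
module Submission where

open import Defs
open import Data.Nat using (ℕ; _≤_; _<_)
open import Data.List using (List; length; _∷_; [])
open import Data.Product using (Σ; _×_; _,_)
open import Relation.Binary.PropositionalEquality using (_≡_; _≢_)
open import Relation.Nullary using (¬_)

open import Data.Bool using (Bool; true; false; not; _xor_)
import Data.Bool.Properties as Bool
open import Data.Empty using (⊥)
open import Data.Fin as Fin using (Fin; zero; suc; toℕ; fromℕ<)
open import Data.Fin.Patterns using (0F; 1F; 2F)
import Data.Fin.Properties as Fin
open import Data.Fin.Permutation.Components using (transpose; transpose-inverse)
open import Data.List as List using (filter; map; cartesianProductWith; allFin)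
open import Data.List.Membership.Propositional using (_∈_; _∉_)
open import Data.List.Membership.Propositional.Properties
  using (∈-lookup; ∈-allFin; ∈-cartesianProductWith⁺; ∈-map∘filter⁺; ∈-map∘filter⁻)
import Data.List.Relation.Unary.All as All
open import Data.List.Relation.Unary.AllPairs using ([]; _∷_)
open import Data.List.Relation.Unary.Any as Any using (here; there)
open import Data.List.Relation.Unary.Any.Properties using (lookup-index)
open import Data.List.Relation.Unary.Unique.Propositional using (Unique)
import Data.List.Relation.Unary.Unique.Propositional.Properties as Unique
open import Data.Nat using (zero; suc; z≤n; s≤s; _<ᵇ_; _+_)
import Data.Nat.Properties as ℕ
open import Data.Product using (∃; proj₁; proj₂)
open import Data.Product.Properties using (,-injectiveˡ)
open import Data.Sum using (_⊎_; inj₁; inj₂; [_,_]′)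
open import Data.Vec as Vec using (Vec; []; _∷_; lookup; _[_]≔_)
open import Data.Vec.Properties as Vec
  using (lookup∘update; lookup∘update′; []≔-commutes; []≔-idempotent; tabulate∘lookup;
         tabulate-cong; lookup-allFin; ∷-injective)
open import Function using (_∘_; id)
open import Function.Definitions using (Injective)
open import Relation.Binary.PropositionalEquality
  using (refl; sym; trans; cong; cong₂; subst; module ≡-Reasoning)
open import Relation.Nullary using (Dec; yes; no; contradiction)
open import Relation.Nullary.Decidable using (map′; _×-dec_; _⊎-dec_; _→-dec_; ¬?; from-yes)

private variable
  m n : ℕ

infix 4 _≟_
_≟_ : (u v : Vec (Fin m) n) → Dec (u ≡ v)
_≟_ = Vec.≡-dec Fin._≟_

-- Swaps and permutations

lookup-ext : {A : Set} {u v : Vec A n} → (∀ k → lookup u k ≡ lookup v k) → u ≡ v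
lookup-ext {u = u} {v} eq =
  trans (sym (tabulate∘lookup u)) (trans (tabulate-cong eq) (tabulate∘lookup v))

lookup-swap : (v : Arr n) (i j k : Fin n) → lookup (swap v i j) k ≡ lookup v (transpose i j k)
lookup-swap v i j k with k Fin.≟ i
lookup-swap v i j k | yes refl with k Fin.≟ j
... | yes refl = lookup∘update k (v [ k ]≔ lookup v k) _
... | no  k≢j  = trans (lookup∘update′ k≢j (v [ k ]≔ lookup v j) _) (lookup∘update k v _)
lookup-swap v i j k | no k≢i with k Fin.≟ j
... | yes refl = lookup∘update k (v [ i ]≔ lookup v k) _
... | no  k≢j  = trans (lookup∘update′ k≢j (v [ i ]≔ lookup v j) _) (lookup∘update′ k≢i v _)

swap-comm : (v : Arr n) (i j : Fin n) → swap v i j ≡ swap v j i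
swap-comm v i j with i Fin.≟ j
... | yes refl = refl
... | no  i≢j  = []≔-commutes v i j i≢j

swap-involutive : (v : Arr n) (i j : Fin n) → swap (swap v i j) i j ≡ v
swap-involutive v i j = lookup-ext λ k → begin
  lookup (swap (swap v i j) i j) k            ≡⟨ lookup-swap (swap v i j) i j k ⟩
  lookup (swap v i j) (transpose i j k)       ≡⟨ cong (λ w → lookup w (transpose i j k)) (swap-comm v i j) ⟩
  lookup (swap v j i) (transpose i j k)       ≡⟨ lookup-swap v j i _ ⟩
  lookup v (transpose j i (transpose i j k))  ≡⟨ cong (lookup v) (transpose-inverse j i) ⟩
  lookup v k                                  ∎
  where open ≡-Reasoning

IsPerm-swap : (v : Arr n) (i j : Fin n) → IsPerm v → IsPerm (swap v i j)
IsPerm-swap v i j (inj , surj) = inj′ , surj′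
  where
  inj′ : Injective _≡_ _≡_ (lookup (swap v i j))
  inj′ {a} {b} eq = trans (sym (transpose-inverse j i)) (trans (cong (transpose j i) πa≡πb) (transpose-inverse j i))
    where
    πa≡πb : transpose i j a ≡ transpose i j b
    πa≡πb = inj (trans (sym (lookup-swap v i j a)) (trans eq (lookup-swap v i j b)))
  surj′ : ∀ y → ∃ λ x → ∀ {z} → z ≡ x → lookup (swap v i j) z ≡ y
  surj′ y with x , fx ← surj y = transpose j i x , λ where
    refl → trans (lookup-swap v i j _) (trans (cong (lookup v) (transpose-inverse i j)) (fx refl))

isPerm? : (v : Arr n) → Dec (IsPerm v)
isPerm? v = injective? ×-dec surjective?
  where
  injective? = map′ (λ h {i} {j} → h i j) (λ inj i j → inj)
    (Fin.all? λ i → Fin.all? λ j → (lookup v i Fin.≟ lookup v j) →-dec (i Fin.≟ j))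
  surjective? = map′ (λ h y → proj₁ (h y) , λ where refl → proj₂ (h y))
                     (λ h y → proj₁ (h y) , proj₂ (h y) refl)
    (Fin.all? λ y → Fin.any? λ x → lookup v x Fin.≟ y)

IsPerm-allFin : IsPerm (Vec.allFin n)
IsPerm-allFin =
  (λ {i} {j} eq → trans (sym (lookup-allFin i)) (trans eq (lookup-allFin j))) ,
  (λ y → y , λ where refl → lookup-allFin y)

-- Inversion parity

below : Fin m → Vec (Fin m) n → Bool
below x []       = false
below x (y ∷ ys) = (toℕ y <ᵇ toℕ x) xor below x ys

-- Inversions modulo 2, defined for any vector over `Fin m` so that the recursion can pass to tails,
-- which are not permutations.
parity : Vec (Fin m) n → Bool
parity []       = false
parity (x ∷ xs) = below x xs xor parity xs

xor-left-comm : ∀ a b c → a xor (b xor c) ≡ b xor (a xor c)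
xor-left-comm false b     c = refl
xor-left-comm true  false c = refl
xor-left-comm true  true  c = refl

-- `below z` is an xor over the entries, so their order does not matter.
below-swap-head : (z x : Fin m) (xs : Vec (Fin m) n) (j : Fin n) →
  below z (lookup xs j ∷ xs [ j ]≔ x) ≡ below z (x ∷ xs)
below-swap-head z x (y ∷ ys) zero =
  xor-left-comm (toℕ y <ᵇ toℕ z) (toℕ x <ᵇ toℕ z) (below z ys)
below-swap-head z x (y ∷ ys) (suc j) = begin
  a xor (b xor below z (ys [ j ]≔ x))  ≡⟨ xor-left-comm a b _ ⟩
  b xor (a xor below z (ys [ j ]≔ x))  ≡⟨ cong (b xor_) (below-swap-head z x ys j) ⟩
  b xor (d xor below z ys)             ≡⟨ xor-left-comm b d _ ⟩
  d xor (b xor below z ys)             ∎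
  where
  open ≡-Reasoning
  a = toℕ (lookup ys j) <ᵇ toℕ z
  b = toℕ y <ᵇ toℕ z
  d = toℕ x <ᵇ toℕ z

-- [swap] requires as many symbols as positions, which tails of an arrangement violate.
exchange : Vec (Fin m) n → Fin n → Fin n → Vec (Fin m) n
exchange v i j = (v [ i ]≔ lookup v j) [ j ]≔ lookup v i

below-exchange : (z : Fin m) (v : Vec (Fin m) n) (i j : Fin n) → i ≢ j →
  below z (exchange v i j) ≡ below z v
below-exchange z (x ∷ xs) zero    zero    i≢j = contradiction refl i≢j
below-exchange z (x ∷ xs) zero    (suc j) _   = below-swap-head z x xs j
below-exchange z (x ∷ xs) (suc i) zero    _   = below-swap-head z x xs i
below-exchange z (x ∷ xs) (suc i) (suc j) i≢j =
  cong ((toℕ x <ᵇ toℕ z) xor_) (below-exchange z xs i j (i≢j ∘ cong suc))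

<ᵇ-flip : ∀ {a b} → a ≢ b → (a <ᵇ b) ≡ not (b <ᵇ a)
<ᵇ-flip {zero}  {zero}  a≢b = contradiction refl a≢b
<ᵇ-flip {zero}  {suc b} _   = refl
<ᵇ-flip {suc a} {zero}  _   = refl
<ᵇ-flip {suc a} {suc b} a≢b = <ᵇ-flip (a≢b ∘ cong suc)

-- All comparisons except that of `x` with `y` occur on both sides; that one is negated.
parity-adjacent : {x y : Fin m} (xs : Vec (Fin m) n) → x ≢ y →
  parity (y ∷ x ∷ xs) ≡ not (parity (x ∷ y ∷ xs))
parity-adjacent {x = x} {y} xs x≢y rewrite <ᵇ-flip (x≢y ∘ Fin.toℕ-injective) =
  rearrange (toℕ y <ᵇ toℕ x) (below y xs) (below x xs) (parity xs)
  where
  rearrange : ∀ a b c d → (not a xor b) xor (c xor d) ≡ not ((a xor c) xor (b xor d))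
  rearrange false false c     d = refl
  rearrange false true  false d = sym (Bool.not-involutive d)
  rearrange false true  true  d = sym (Bool.not-involutive (not d))
  rearrange true  false false d = sym (Bool.not-involutive d)
  rearrange true  false true  d = refl
  rearrange true  true  false d = sym (Bool.not-involutive (not d))
  rearrange true  true  true  d = refl

-- A transposition reaching deeper is conjugated by the exchange of the first two positions: two
-- adjacent exchanges and one shorter transposition, three flips in all.
parity-swap-head : (x : Fin m) (xs : Vec (Fin m) n) (j : Fin n) →
  Injective _≡_ _≡_ (lookup (x ∷ xs)) → parity (lookup xs j ∷ xs [ j ]≔ x) ≡ not (parity (x ∷ xs))
parity-swap-head x (y ∷ ys) zero    inj = parity-adjacent ys λ x≡y → 0≢1 (inj {zero} {suc zero} x≡y)
  where
  0≢1 : zero ≢ suc zero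
  0≢1 ()
parity-swap-head x (z ∷ zs) (suc j) inj = begin
  parity (y ∷ z ∷ zs′)
    ≡⟨ parity-adjacent zs′ z≢y ⟩
  not (below z (y ∷ zs′) xor parity (y ∷ zs′))
    ≡⟨ cong₂ (λ a b → not (a xor b)) (below-swap-head z x zs j) (parity-swap-head x zs j inj′) ⟩
  not (below z (x ∷ zs) xor not (parity (x ∷ zs)))
    ≡⟨ cong not (sym (Bool.not-distribʳ-xor (below z (x ∷ zs)) _)) ⟩
  not (not (parity (z ∷ x ∷ zs)))
    ≡⟨ cong (not ∘ not) (parity-adjacent zs x≢z) ⟩
  not (not (not (parity (x ∷ z ∷ zs))))
    ≡⟨ Bool.not-involutive _ ⟩
  not (parity (x ∷ z ∷ zs)) ∎
  where
  open ≡-Reasoning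
  y   = lookup zs j
  zs′ = zs [ j ]≔ x
  z≢y : z ≢ y
  z≢y eq with () ← inj {suc zero} {suc (suc j)} eq
  x≢z : x ≢ z
  x≢z eq with () ← inj {zero} {suc zero} eq
  inj′ : Injective _≡_ _≡_ (lookup (x ∷ zs))
  inj′ {zero}  {zero}  _  = refl
  inj′ {zero}  {suc b} eq with () ← inj {zero} {suc (suc b)} eq
  inj′ {suc a} {zero}  eq with () ← inj {suc (suc a)} {zero} eq
  inj′ {suc a} {suc b} eq with refl ← inj {suc (suc a)} {suc (suc b)} eq = refl

parity-exchange : (v : Vec (Fin m) n) (i j : Fin n) → i ≢ j → Injective _≡_ _≡_ (lookup v) →
  parity (exchange v i j) ≡ not (parity v)
parity-exchange (x ∷ xs) zero    zero    i≢j _   = contradiction refl i≢j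
parity-exchange (x ∷ xs) zero    (suc j) _   inj = parity-swap-head x xs j inj
parity-exchange (x ∷ xs) (suc i) zero    _   inj = parity-swap-head x xs i inj
parity-exchange (x ∷ xs) (suc i) (suc j) i≢j inj = begin
  below x (exchange xs i j) xor parity (exchange xs i j)
    ≡⟨ cong₂ _xor_ (below-exchange x xs i j i≢j′) (parity-exchange xs i j i≢j′ (Fin.suc-injective ∘ inj)) ⟩
  below x xs xor not (parity xs)
    ≡⟨ sym (Bool.not-distribʳ-xor (below x xs) _) ⟩
  not (below x xs xor parity xs) ∎
  where
  open ≡-Reasoning
  i≢j′ = i≢j ∘ cong suc

parity-swap : {v : Arr n} {i j : Fin n} → i ≢ j → IsPerm v → parity (swap v i j) ≡ not (parity v)
parity-swap {v = v} i≢j (inj , _) = parity-exchange v _ _ i≢j inj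

Adj⇒swap : {u v : Arr n} → Adj u v → ∃ λ i → ∃ λ j → i ≢ j × u ≡ swap v i j
Adj⇒swap (inj₁ (i , j , i≡0 , 1≤j , eq)) = i , j ,
  (λ where refl → ℕ.1+n≰n (subst (1 ≤_) i≡0 1≤j)) , eq
Adj⇒swap (inj₂ (i , j , _ , j≡1+i , eq)) = i , j ,
  (λ where refl → ℕ.1+n≢n (sym j≡1+i)) , eq

Adj-sym : {u v : Arr n} → Adj u v → Adj v u
Adj-sym (inj₁ (i , j , i≡0 , 1≤j , refl))   = inj₁ (i , j , i≡0 , 1≤j , sym (swap-involutive _ i j))
Adj-sym (inj₂ (i , j , 1≤i , j≡1+i , refl)) = inj₂ (i , j , 1≤i , j≡1+i , sym (swap-involutive _ i j))

Adj-parity : (u v : Arr n) → IsPerm v → Adj u v → parity u ≡ not (parity v)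
Adj-parity _ v v-perm u∼v with i , j , i≢j , refl ← Adj⇒swap u∼v = parity-swap {v = v} i≢j v-perm

-- Arrangements form a finite type

vectors : ∀ m n → List (Vec (Fin m) n)
vectors m zero    = [] ∷ []
vectors m (suc n) = cartesianProductWith _∷_ (allFin m) (vectors m n)

∈-vectors : (v : Vec (Fin m) n) → v ∈ vectors m n
∈-vectors []       = here refl
∈-vectors (x ∷ xs) = ∈-cartesianProductWith⁺ _∷_ (∈-allFin x) (∈-vectors xs)

vectors-unique : ∀ m n → Unique (vectors m n)
vectors-unique m zero    = All.[] ∷ []
vectors-unique m (suc n) = Unique.cartesianProductWith⁺ _∷_ ∷-injective (Unique.allFin⁺ m) (vectors-unique m n)

-- `IsMatching` compares edges by their indices in the list; without duplicates, distinct indices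
-- mean distinct edges.
lookup-unique : {A : Set} {xs : List A} → Unique xs → Injective _≡_ _≡_ (List.lookup xs)
lookup-unique (x∉xs ∷ _) {zero}  {zero}  _  = refl
lookup-unique (x∉xs ∷ _) {zero}  {suc j} eq = contradiction eq (All.lookup x∉xs (∈-lookup j))
lookup-unique (x∉xs ∷ _) {suc i} {zero}  eq = contradiction (sym eq) (All.lookup x∉xs (∈-lookup i))
lookup-unique (_ ∷ xs!)  {suc i} {suc j} eq = cong suc (lookup-unique xs! eq)

-- Pigeonhole: `t` together with the values of `h` would be one more distinct value than there are
-- arrangements. Here `h` acts on all arrangements, permutations or not, so that `vectors`
-- enumerates its domain.
injective⇒hits : {h : Arr n → Arr n} → Injective _≡_ _≡_ h → ∀ t → ¬ (∀ w → h w ≢ t)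
injective⇒hits {n} {h} h-inj t misses = distinct (Fin.pigeonhole (ℕ.n<1+n _) (code ∘ f))
  where
  arrs = vectors n n
  code : Arr n → Fin (length arrs)
  code v = Any.index (∈-vectors v)
  code-injective : Injective _≡_ _≡_ code
  code-injective {u} {v} eq = trans (lookup-index (∈-vectors u))
    (trans (cong (List.lookup arrs) eq) (sym (lookup-index (∈-vectors v))))
  f : Fin (suc (length arrs)) → Arr n
  f zero    = t
  f (suc i) = h (List.lookup arrs i)
  distinct : ¬ (∃ λ i → ∃ λ j → i Fin.< j × code (f i) ≡ code (f j))
  distinct (zero  , suc j , _   , eq) = misses _ (sym (code-injective eq))
  distinct (suc i , suc j , i<j , eq) =
    Fin.<⇒≢ i<j (cong suc (lookup-unique (vectors-unique n n) (h-inj (code-injective eq))))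

-- Matchings from partner functions

-- `D` is the set to be covered; it is smaller than the vertex set left by `F` when one vertex has
-- to stay uncovered.
module FromPartner {F : List (Elem n)} {D : Arr n → Set} (D? : ∀ w → Dec (D w)) (f : Arr n → Arr n)
  (edge : ∀ {w} → D w → EdgeOf F w (f w))
  (closed : ∀ {w} → D w → D (f w))
  (involutive : ∀ {w} → D w → f (f w) ≡ w) where

  -- Each edge of the matching is listed from its end of parity [false].
  rep? : ∀ w → Dec (D w × parity w ≡ false)
  rep? w = D? w ×-dec (parity w Bool.≟ false)

  edgeAt : Arr n → Arr n × Arr n
  edgeAt w = w , f w

  matching : List (Arr n × Arr n)
  matching = map edgeAt (filter rep? (vectors n n))

  matching⁻ : ∀ {e} → e ∈ matching → ∃ λ w → e ≡ (w , f w) × D w × parity w ≡ false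
  matching⁻ e∈M with w , _ , eq , Dw , pw ← ∈-map∘filter⁻ edgeAt rep? {xs = vectors n n} e∈M = w , eq , Dw , pw

  parity-partner : ∀ {w} → D w → parity (f w) ≡ not (parity w)
  parity-partner {w} Dw with (w-perm , _) , _ , w∼fw , _ ← edge Dw = Adj-parity (f w) w w-perm (Adj-sym {u = w} w∼fw)

  -- Partners are adjacent and so differ in parity, whereas representatives all have parity `false`.
  partner-odd : ∀ {u w} → D w → parity u ≡ false → parity w ≡ false → u ≢ f w
  partner-odd Dw pu pw refl with () ← trans (sym pu) (trans (parity-partner Dw) (cong not pw))

  disjoint : ∀ {e e′} → e ∈ matching → e′ ∈ matching → e ≢ e′ → ∀ w → Incident w e → ¬ Incident w e′
  disjoint e∈ e′∈ e≢e′ w ie ie′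
    with u , refl , Du , pu ← matching⁻ e∈ | v , refl , Dv , pv ← matching⁻ e′∈ with ie | ie′
  ... | inj₁ refl | inj₁ refl = e≢e′ refl
  ... | inj₁ refl | inj₂ eq   = partner-odd Dv pu pv eq
  ... | inj₂ eq   | inj₁ refl = partner-odd Du pv pu eq
  ... | inj₂ refl | inj₂ eq   = e≢e′ (cong edgeAt
    (trans (sym (involutive Du)) (trans (cong f eq) (involutive Dv))))

  isMatching : IsMatching F matching
  isMatching = (λ e e∈M → isEdge (matching⁻ e∈M)) , λ i j i≢j →
    disjoint (∈-lookup i) (∈-lookup j) (i≢j ∘ lookup-unique matching-unique)
    where
    isEdge : ∀ {e} → (∃ λ w → e ≡ (w , f w) × D w × parity w ≡ false) → EdgeOf F (proj₁ e) (proj₂ e)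
    isEdge (w , refl , Dw , _) = edge Dw
    matching-unique : Unique matching
    matching-unique = Unique.map⁺ ,-injectiveˡ (Unique.filter⁺ rep? (vectors-unique n n))

  covers⁺ : ∀ {w} → D w → Covers matching w
  covers⁺ {w} Dw with parity w in pw
  ... | false = (w , f w) , ∈-map∘filter⁺ edgeAt rep? (w , ∈-vectors w , refl , Dw , pw) , inj₁ refl
  ... | true  = (f w , f (f w)) ,
    ∈-map∘filter⁺ edgeAt rep? (f w , ∈-vectors (f w) , refl , closed Dw , trans (parity-partner Dw) (cong not pw)) ,
    inj₂ (sym (involutive Dw))

  covers⁻ : ∀ {w} → Covers matching w → D w
  covers⁻ (e , e∈M , i) with u , refl , Du , _ ← matching⁻ e∈M with i
  ... | inj₁ refl = Du
  ... | inj₂ refl = closed Du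

-- Sets with at most one deleted vertex

-- Two star edges and the first bubble-sort edge, all present from dimension 3 on.
ends : Fin 3 → Fin (3 + m) × Fin (3 + m)
ends 0F = 0F , 1F
ends 1F = 0F , 2F
ends 2F = 1F , 2F

colour : Fin 3 → Arr (3 + m) → Arr (3 + m)
colour k v = swap v (proj₁ (ends k)) (proj₂ (ends k))

colour-involutive : (k : Fin 3) (v : Arr (3 + m)) → colour k (colour k v) ≡ v
colour-involutive k v = swap-involutive v _ _

colour-injective : (k : Fin 3) (u v : Arr (3 + m)) → colour k u ≡ colour k v → u ≡ v
colour-injective k u v eq =
  trans (sym (colour-involutive k u)) (trans (cong (colour k) eq) (colour-involutive k v))

IsPerm-colour : (k : Fin 3) (v : Arr (3 + m)) → IsPerm v → IsPerm (colour k v)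
IsPerm-colour k v = IsPerm-swap v _ _

colour-adj : (k : Fin 3) (v : Arr (3 + m)) → Adj v (colour k v)
colour-adj 0F v = Adj-sym (inj₁ (0F , 1F , refl , s≤s z≤n , refl))
colour-adj 1F v = Adj-sym (inj₁ (0F , 2F , refl , s≤s z≤n , refl))
colour-adj 2F v = Adj-sym (inj₂ (1F , 2F , s≤s z≤n , refl , refl))

Adj⇒≢ : {u v : Arr n} → IsPerm v → Adj u v → u ≢ v
Adj⇒≢ {v = v} v-perm u∼v refl = Bool.not-¬ refl (Adj-parity v v v-perm u∼v)

-- The position that supplies the first entry after the exchange; this alone tells the three colours
-- apart.
newHead : Fin 3 → Fin (3 + m)
newHead 0F = 1F
newHead 1F = 2F
newHead 2F = 0F

newHead-injective : ∀ k l → newHead {m} k ≡ newHead l → k ≡ l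
newHead-injective 0F 0F _ = refl
newHead-injective 1F 1F _ = refl
newHead-injective 2F 2F _ = refl
newHead-injective 0F 1F ()
newHead-injective 0F 2F ()
newHead-injective 1F 0F ()
newHead-injective 1F 2F ()
newHead-injective 2F 0F ()
newHead-injective 2F 1F ()

head-colour : (k : Fin 3) (v : Arr (3 + m)) → lookup (colour k v) 0F ≡ lookup v (newHead k)
head-colour 0F (_ ∷ _ ∷ _ ∷ _) = refl
head-colour 1F (_ ∷ _ ∷ _ ∷ _) = refl
head-colour 2F (_ ∷ _ ∷ _ ∷ _) = refl

colours-disjoint : {v : Arr (3 + m)} (k l : Fin 3) → IsPerm v → colour k v ≡ colour l v → k ≡ l
colours-disjoint {v = v} k l (inj , _) eq = newHead-injective k l
  (inj (trans (sym (head-colour k v)) (trans (cong (λ w → lookup w 0F) eq) (head-colour l v))))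

-- Both orientations are meant: the reversed edge is the same expression taken at `colour k x`.
Avoids : Fin 3 → List (Elem (3 + m)) → Set
Avoids k F = ∀ x → edg x (colour k x) ∉ F

edg-injective : {a b c d : Arr n} → edg a b ≡ edg c d → a ≡ c × b ≡ d
edg-injective refl = refl , refl

-- The three matchings are edge-disjoint, so an edge can lie in only one of them.
soleColour : (e : Elem (3 + m)) → ValidElem e → ∃ λ k → ∀ l x → e ≡ edg x (colour l x) → l ≡ k
-- A vertex blocks no colour, and `0F` is an arbitrary default; likewise below for an edge of none
-- of the three colours.
soleColour (vtx _)   _ = 0F , λ _ _ ()
soleColour (edg x y) (x-perm , _) with Fin.any? (λ k → y ≟ colour k x)
... | yes (k , refl) = k , λ where l _ eq → sole l eq
  where
  sole : ∀ l {z} → edg x (colour k x) ≡ edg z (colour l z) → l ≡ k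
  sole l eq with refl , eq′ ← edg-injective eq = colours-disjoint l k x-perm (sym eq′)
... | no  none       = 0F , λ where l _ refl → contradiction (l , refl) none

otherColour : ∀ (k l : Fin 3) → ∃ λ i → i ≢ k × i ≢ l
otherColour = from-yes (Fin.all? λ k → Fin.all? λ l → Fin.any? {n = 3} λ i →
  ¬? (i Fin.≟ k) ×-dec ¬? (i Fin.≟ l))

-- Each element blocks at most one colour, so two of them leave a third free.
freeColour : (F : List (Elem (3 + m))) → length F ≤ 2 → AllValid F → ∃ λ k → Avoids k F
freeColour []               _ _     = 0F , λ _ ()
freeColour (e ∷ [])         _ valid with k , sole ← soleColour e (valid e (here refl))
  with i , i≢k , _ ← otherColour k k = i , λ where x (here eq) → i≢k (sole i x (sym eq))
freeColour (e₁ ∷ e₂ ∷ [])   _ valid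
  with k , sole₁ ← soleColour e₁ (valid e₁ (here refl))
     | l , sole₂ ← soleColour e₂ (valid e₂ (there (here refl)))
  with i , i≢k , i≢l ← otherColour k l = i , λ where
    x (here eq)         → i≢k (sole₁ i x (sym eq))
    x (there (here eq)) → i≢l (sole₂ i x (sym eq))
freeColour (_ ∷ _ ∷ _ ∷ _)  (s≤s (s≤s ())) _

module _ {F : List (Elem (3 + m))} (k : Fin 3) (avoids : Avoids k F) where

  colourEdge : ∀ {w} → VertexOf F w → VertexOf F (colour k w) → EdgeOf F w (colour k w)
  colourEdge {w} w∈ cw∈ = w∈ , cw∈ , colour-adj k w , avoids w ,
    λ e∈F → avoids (colour k w) (subst (λ x → edg (colour k w) x ∈ F) (sym (colour-involutive k w)) e∈F)

  perfect : (∀ v → vtx v ∉ F) → HasPerfectMatching F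
  perfect noVertex = matching , isMatching , λ w w∈ → covers⁺ (proj₁ w∈)
    where
    open FromPartner {F = F} {D = IsPerm} isPerm? (colour k)
      (λ {w} w-perm → colourEdge (w-perm , noVertex w) (IsPerm-colour k w w-perm , noVertex _))
      (λ {w} → IsPerm-colour k w) (λ {w} _ → colour-involutive k w)

  -- Deleting `v` isolates only its partner: `colour k v` stays uncovered and all other pairs
  -- survive.
  almostPerfect : ∀ {v} → IsPerm v → vtx v ∈ F → (∀ w → vtx w ∈ F → w ≡ v) → HasAlmostPerfectMatching F
  almostPerfect {v} v-perm v∈F only = matching , isMatching , colour k v , cv-vertex ,
    (λ cov → proj₂ (proj₂ (covers⁻ cov)) refl) ,
    λ w w∈ w≢cv → covers⁺ (proj₁ w∈ , (λ where refl → proj₂ w∈ v∈F) , w≢cv)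
    where
    cv-vertex : VertexOf F (colour k v)
    cv-vertex = IsPerm-colour k v v-perm ,
      λ cv∈F → Adj⇒≢ v-perm (Adj-sym {u = v} (colour-adj k v)) (only _ cv∈F)
    Remaining : Arr (3 + m) → Set
    Remaining w = IsPerm w × w ≢ v × w ≢ colour k v
    vertex : ∀ {w} → Remaining w → VertexOf F w
    vertex (w-perm , w≢v , _) = w-perm , λ w∈F → w≢v (only _ w∈F)
    closed : ∀ {w} → Remaining w → Remaining (colour k w)
    closed {w} (w-perm , w≢v , w≢cv) = IsPerm-colour k w w-perm ,
      (λ where refl → w≢cv (sym (colour-involutive k w))) ,
      (λ eq → w≢v (colour-injective k w v eq))
    open FromPartner {F = F} (λ w → isPerm? w ×-dec ¬? (w ≟ v) ×-dec ¬? (w ≟ colour k v)) (colour k)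
      (λ r → colourEdge (vertex r) (vertex (closed r))) closed (λ {w} _ → colour-involutive k w)

-- Alternating paths

τ : Arr (3 + m) → Arr (3 + m)
τ = colour 0F

star : Fin (3 + m) → Arr (3 + m) → Arr (3 + m)
star j v = swap v 0F j

-- A 3-cycle of the positions 0, 1 and `j` + 2: an edge of the matching `τ` followed by a star edge
-- outside it.
rotate : Fin (1 + m) → Arr (3 + m) → Arr (3 + m)
rotate j v = star (suc (suc j)) (τ v)

τ-adj-rotate : (j : Fin (1 + m)) (v : Arr (3 + m)) → Adj (rotate j v) (τ v)
τ-adj-rotate j v = inj₁ (0F , suc (suc j) , refl , s≤s z≤n , refl)

-- A 3-cycle is the inverse of its square.
rotate-rotate : (j : Fin (1 + m)) (v : Arr (3 + m)) → rotate j (rotate j v) ≡ τ (star (suc (suc j)) v)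
rotate-rotate j (a ∷ b ∷ xs) = cong₂ (λ x ys → x ∷ lookup xs j ∷ ys)
  (lookup∘update j xs b) ([]≔-idempotent xs j)

IsPerm-rotate : (j : Fin (1 + m)) (v : Arr (3 + m)) → IsPerm v → IsPerm (rotate j v)
IsPerm-rotate j v v-perm = IsPerm-swap (τ v) _ _ (IsPerm-colour 0F v v-perm)

parity-τ : (v : Arr (3 + m)) → IsPerm v → parity (τ v) ≡ not (parity v)
parity-τ v v-perm = Adj-parity (τ v) v v-perm (Adj-sym {u = v} (colour-adj 0F v))

parity-rotate : (j : Fin (1 + m)) (v : Arr (3 + m)) → IsPerm v → parity (rotate j v) ≡ parity v
parity-rotate j v v-perm = begin
  parity (rotate j v)  ≡⟨ Adj-parity (rotate j v) (τ v) (IsPerm-colour 0F v v-perm) (τ-adj-rotate j v) ⟩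
  not (parity (τ v))   ≡⟨ cong not (parity-τ v v-perm) ⟩
  not (not (parity v)) ≡⟨ Bool.not-involutive _ ⟩
  parity v             ∎
  where open ≡-Reasoning

mutual
  -- Only every other vertex of the alternating path is recorded. The path is kept simple so that,
  -- in `alternate`, the edge from `x` to `τ x` still belongs to the matching built for the rest.
  data Path (t : Arr (3 + m)) : Arr (3 + m) → Set where
    done : Path t t
    step : ∀ {x} (j : Fin (1 + m)) (p : Path t (rotate j x)) → ¬ OnPath x p → Path t x

  OnPath : {t x : Arr (3 + m)} → Arr (3 + m) → Path t x → Set
  OnPath {t = t} w done             = w ≡ t
  OnPath         w (step {x} j p _) = w ≡ x ⊎ OnPath w p

module _ {t : Arr (3 + m)} where

  onPath? : ∀ w {x} (p : Path t x) → Dec (OnPath w p)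
  onPath? w done             = w ≟ t
  onPath? w (step {x} j p _) = (w ≟ x) ⊎-dec onPath? w p

  suffix : ∀ {w x} (p : Path t x) → OnPath w p → Path t w
  suffix done         refl        = done
  suffix (step j p ∉) (inj₁ refl) = step j p ∉
  suffix (step j p _) (inj₂ w∈p)  = suffix p w∈p

  -- Loop erasure: if `x` already lies on the path, the part from `x` onwards is taken instead.
  extend : ∀ {x} (j : Fin (1 + m)) → Path t (rotate j x) → Path t x
  extend {x} j p with onPath? x p
  ... | yes x∈p = suffix p x∈p
  ... | no  x∉p = step j p x∉p

  -- Rotations are even, so a path stays in one parity class; `x` and `τ x` represent the two
  -- classes.
  Reaches : Arr (3 + m) → Set
  Reaches x = Path t x ⊎ Path t (τ x)

  -- The star edge at position 1 is `τ` and exchanges the two alternatives. Any later star neighbour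
  -- of `x` is one rotation away from `τ x`, and its image under `τ` is two rotations away from `x`.
  reaches-star : ∀ (j : Fin (3 + m)) {x} → Reaches (star j x) → Reaches x
  -- Exchanging position 0 with itself computes to the identity once the vector is a cons.
  reaches-star 0F            {_ ∷ _} r        = r
  reaches-star 1F            {x}     (inj₁ p) = inj₂ p
  reaches-star 1F            {x}     (inj₂ p) = inj₁ (subst (Path t) (colour-involutive 0F x) p)
  reaches-star (suc (suc j)) {x}     (inj₁ p) =
    inj₂ (extend j (subst (λ w → Path t (star (suc (suc j)) w)) (sym (colour-involutive 0F x)) p))
  reaches-star (suc (suc j)) {x}     (inj₂ p) =
    inj₁ (extend j (extend j (subst (Path t) (sym (rotate-rotate j x)) p)))

  -- Positions k, k+1, … already agree with t; two star edges put the right symbol at position k − 1.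
  reaches-from : IsPerm t → ∀ k → k ≤ 3 + m → ∀ x → IsPerm x →
    (∀ i → k ≤ toℕ i → lookup x i ≡ lookup t i) → Reaches x
  reaches-from t-perm zero    _   x _ agree = inj₁ (subst (Path t) (sym (lookup-ext λ i → agree i z≤n)) done)
  reaches-from t-perm (suc k) k<n x x-perm agree
    with j , xj≡ ← proj₂ x-perm (lookup t (fromℕ< k<n)) =
    reaches-star j (reaches-star i (reaches-from t-perm k (ℕ.<⇒≤ k<n) x″
      (IsPerm-swap x′ _ _ (IsPerm-swap x _ _ x-perm)) agree″))
    where
    i  = fromℕ< k<n
    x′ = star j x
    x″ = star i x′
    -- Beyond `k` the arrangements agree, so a larger `j` would make `t` carry the same symbol at
    -- two positions. Hence the star edge at `j` leaves the settled positions alone.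
    j≤k : toℕ j ≤ k
    j≤k with toℕ j ℕ.≤? k
    ... | yes le = le
    ... | no  gt = contradiction
      (trans (cong toℕ (proj₁ t-perm (trans (sym (agree j (ℕ.≰⇒> gt))) (xj≡ refl)))) (Fin.toℕ-fromℕ< k<n))
      (λ eq → gt (ℕ.≤-reflexive eq))
    head-x′ : lookup x′ 0F ≡ lookup t i
    head-x′ = trans (head-star j x) (xj≡ refl)
      where
      head-star : ∀ j x → lookup (star j x) 0F ≡ lookup x j
      head-star 0F      (_ ∷ _) = refl
      head-star (suc _) (_ ∷ _) = refl
    above≢ : ∀ {a l} → toℕ a ≤ k → k < toℕ l → l ≢ a
    above≢ a≤k k<l refl = ℕ.<⇒≱ k<l a≤k
    i≤k : toℕ i ≤ k
    i≤k = ℕ.≤-reflexive (Fin.toℕ-fromℕ< k<n)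
    star-above : ∀ a x {l} → toℕ a ≤ k → k < toℕ l → lookup (star a x) l ≡ lookup x l
    star-above a x a≤k k<l = trans (lookup∘update′ (above≢ a≤k k<l) (x [ 0F ]≔ lookup x a) _)
      (lookup∘update′ (above≢ z≤n k<l) x _)
    agree″ : ∀ l → k ≤ toℕ l → lookup x″ l ≡ lookup t l
    agree″ l k≤l with l Fin.≟ i
    ... | yes refl = trans (lookup∘update l (x′ [ 0F ]≔ lookup x′ l) _) head-x′
    ... | no  l≢i  = trans (star-above i x′ i≤k k<l) (trans (star-above j x j≤k k<l) (agree l k<l))
      where
      k<l : k < toℕ l
      k<l = ℕ.≤∧≢⇒< k≤l λ k≡l → l≢i (Fin.toℕ-injective (trans (sym k≡l) (sym (Fin.toℕ-fromℕ< k<n))))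

  reaches : IsPerm t → ∀ x → IsPerm x → Reaches x
  reaches t-perm x x-perm = reaches-from t-perm (3 + m) ℕ.≤-refl x x-perm
    λ i n≤i → contradiction (Fin.toℕ<n i) (ℕ.≤⇒≯ n≤i)

module _ (c : Arr (3 + m) → Bool) (proper : ∀ x y → IsPerm x → Adj x y → c x ≢ c y) where

  proper-adj : ∀ {x y} → IsPerm x → Adj x y → c x ≡ not (c y)
  proper-adj x-perm x∼y = Bool.¬-not (proper _ _ x-perm x∼y)

  -- Each step crosses two edges, so the colour flips twice.
  proper-path : ∀ {t x} → IsPerm x → Path t x → c x ≡ c t
  proper-path         _      done         = refl
  proper-path {t} {x} x-perm (step j p _) = begin
    c x                        ≡⟨ proper-adj x-perm (colour-adj 0F x) ⟩
    not (c (τ x))              ≡⟨ cong not (proper-adj (IsPerm-colour 0F x x-perm) τx∼rx) ⟩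
    not (not (c (rotate j x))) ≡⟨ Bool.not-involutive _ ⟩
    c (rotate j x)             ≡⟨ proper-path (IsPerm-rotate j x x-perm) p ⟩
    c t                        ∎
    where
    open ≡-Reasoning
    τx∼rx : Adj (τ x) (rotate j x)
    τx∼rx = Adj-sym {u = rotate j x} (τ-adj-rotate j x)

-- Deleting two vertices of opposite parity

Off : (a b w : Arr n) → Set
Off a b w = IsPerm w × w ≢ a × w ≢ b

-- A perfect matching of the graph without `a` and `b`, kept as a function so that `shift` can
-- reroute it at two points; its values outside `Off a b` are arbitrary.
record MatchingOff (a b : Arr n) : Set where
  field
    partner    : Arr n → Arr n
    closed     : ∀ {w} → Off a b w → Off a b (partner w)
    involutive : ∀ {w} → Off a b w → partner (partner w) ≡ w
    adjacent   : ∀ {w} → Off a b w → Adj w (partner w)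

open MatchingOff

redirect : (a b : Arr n) → (Arr n → Arr n) → Arr n → Arr n
redirect a b f w with w ≟ a | w ≟ b
... | yes _ | _     = b
... | no  _ | yes _ = a
... | no  _ | no  _ = f w

redirect-a : {a : Arr n} (b : Arr n) {f : Arr n → Arr n} → redirect a b f a ≡ b
redirect-a {a = a} b with a ≟ a | a ≟ b
... | yes _   | _ = refl
... | no  a≢a | _ = contradiction refl a≢a

redirect-b : {a b : Arr n} {f : Arr n → Arr n} → b ≢ a → redirect a b f b ≡ a
redirect-b {a = a} {b} b≢a with b ≟ a | b ≟ b
... | yes b≡a | _       = contradiction b≡a b≢a
... | no  _   | yes _   = refl
... | no  _   | no  b≢b = contradiction refl b≢b

redirect-else : {a b w : Arr n} {f : Arr n → Arr n} → w ≢ a → w ≢ b → redirect a b f w ≡ f w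
redirect-else {a = a} {b} {w} w≢a w≢b with w ≟ a | w ≟ b
... | yes w≡a | _       = contradiction w≡a w≢a
... | no  _   | yes w≡b = contradiction w≡b w≢b
... | no  _   | no  _   = refl

-- The matching off {y , b} contains the edge x–a; replacing that edge by a–y frees x instead of y.
shift : {x y a b : Arr n} (M : MatchingOff y b) → Off y b x → Off x b a → Off x b y → y ≢ a →
  partner M x ≡ a → Adj a y → MatchingOff x b
shift {x = x} {y} {a} {b} M x-off a-off y-off y≢a fx≡a a∼y = record
  { partner = f′ ; closed = closed′ ; involutive = involutive′ ; adjacent = adjacent′ }
  where
  f = partner M
  f′ = redirect a y f
  off : ∀ {w} → Off x b w → w ≢ y → Off y b w
  off (w-perm , _ , w≢b) w≢y = w-perm , w≢y , w≢b
  fa≡x : f a ≡ x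
  fa≡x = trans (cong f (sym fx≡a)) (involutive M x-off)
  fw≢a : ∀ {w} → Off x b w → w ≢ y → f w ≢ a
  fw≢a w-off w≢y eq = proj₁ (proj₂ w-off)
    (trans (sym (involutive M (off w-off w≢y))) (trans (cong f eq) fa≡x))
  closed′ : ∀ {w} → Off x b w → Off x b (f′ w)
  closed′ {w} w-off with w ≟ a | w ≟ y
  ... | yes _   | _     = y-off
  ... | no  _   | yes _ = a-off
  ... | no  w≢a | no w≢y with fw-perm , _ , fw≢b ← closed M (off w-off w≢y) =
    fw-perm , (λ eq → w≢a (trans (sym (involutive M (off w-off w≢y))) (trans (cong f eq) fx≡a))) , fw≢b
  involutive′ : ∀ {w} → Off x b w → f′ (f′ w) ≡ w
  involutive′ {w} w-off with w ≟ a | w ≟ y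
  ... | yes refl | _        = redirect-b y≢a
  ... | no  _    | yes refl = redirect-a {a = a} y
  ... | no  w≢a  | no  w≢y  = trans
    (redirect-else (fw≢a w-off w≢y) (proj₁ (proj₂ (closed M (off w-off w≢y)))))
    (involutive M (off w-off w≢y))
  adjacent′ : ∀ {w} → Off x b w → Adj w (f′ w)
  adjacent′ {w} w-off with w ≟ a | w ≟ y
  ... | yes refl | _        = a∼y
  ... | no  _    | yes refl = Adj-sym a∼y
  ... | no  _    | no  w≢y  = adjacent M (off w-off w≢y)

parity-path : {t : Arr (3 + m)} (x : Arr (3 + m)) → IsPerm x → Path t x → parity x ≡ parity t
parity-path x x-perm done         = refl
parity-path x x-perm (step j p _) =
  trans (sym (parity-rotate j x x-perm)) (parity-path (rotate j x) (IsPerm-rotate j x x-perm) p)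

onPath-start : {t x : Arr (3 + m)} (p : Path t x) → OnPath x p
onPath-start done         = refl
onPath-start (step _ _ _) = inj₁ refl

onPath-end : {t x : Arr (3 + m)} (p : Path t x) → OnPath t p
onPath-end done         = refl
onPath-end (step _ p _) = inj₂ (onPath-end p)

-- Induction from the end of the path, where the matching is `τ` without the edge from `t` to `τ t`.
-- The second component records which edges of `τ` survive; it is indexed by their ends in the
-- parity class of `t`, the class of all vertices recorded on the path.
alternate : {t x : Arr (3 + m)} → IsPerm t → IsPerm x → (p : Path t x) →
  Σ (MatchingOff x (τ t)) λ M → ∀ w → parity w ≡ parity t → ¬ OnPath w p → partner M w ≡ τ w
alternate {t = t} t-perm _ done = record
  { partner    = τ
  ; closed     = λ {w} (w-perm , w≢t , w≢τt) → IsPerm-colour 0F w w-perm ,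
      (λ τw≡t → w≢τt (trans (sym (colour-involutive 0F w)) (cong τ τw≡t))) ,
      (λ eq → w≢t (colour-injective 0F w t eq))
  ; involutive = λ {w} _ → colour-involutive 0F w
  ; adjacent   = λ {w} _ → colour-adj 0F w
  } , λ _ _ _ → refl
alternate {t = t} {x} t-perm x-perm (step j p x∉p) =
  -- As `x` is not on `p`, `M` still pairs `x` with `τ x`; now `τ x` is paired with `rotate j x` and
  -- `x` becomes free.
  shift M x-off a-off y-off y≢τx (M-τ x px x∉p) (Adj-sym {u = rotate j x} (τ-adj-rotate j x)) ,
  λ w pw w∉ → trans
    (redirect-else (λ w≡τx → odd x x-perm px w≡τx pw)
      (λ w≡y → w∉ (inj₂ (subst (λ z → OnPath z p) (sym w≡y) (onPath-start p)))))
    (M-τ w pw (w∉ ∘ inj₂))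
  where
  y = rotate j x
  y-perm = IsPerm-rotate j x x-perm
  M = proj₁ (alternate t-perm y-perm p)
  M-τ = proj₂ (alternate t-perm y-perm p)
  px : parity x ≡ parity t
  px = parity-path x x-perm (step j p x∉p)
  py : parity y ≡ parity t
  py = parity-path y y-perm p
  odd : ∀ v {w} → IsPerm v → parity v ≡ parity t → w ≡ τ v → parity w ≢ parity t
  odd v v-perm pv refl pτv = Bool.not-¬ pτv (trans (parity-τ v v-perm) (cong not pv))
  y≢τx : y ≢ τ x
  y≢τx eq = odd x x-perm px eq py
  x≢y : x ≢ y
  x≢y x≡y = x∉p (subst (λ w → OnPath w p) (sym x≡y) (onPath-start p))
  x-off : Off y (τ t) x
  x-off = x-perm , x≢y , λ eq → odd t t-perm refl eq px
  -- If `τ x` were `τ t`, then `x` would be the end of `p`, against simplicity.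
  a-off : Off x (τ t) (τ x)
  a-off = IsPerm-colour 0F x x-perm , (λ eq → odd x x-perm px (sym eq) px) ,
    λ eq → x∉p (subst (λ w → OnPath w p) (sym (colour-injective 0F x t eq)) (onPath-end p))
  y-off : Off x (τ t) y
  y-off = y-perm , x≢y ∘ sym , λ eq → odd t t-perm refl eq py

matchingOff⇒perfect : {u v : Arr n} → MatchingOff u v → HasPerfectMatching (vtx u ∷ vtx v ∷ [])
matchingOff⇒perfect {u = u} {v} M = matching , isMatching , λ w (w-perm , w∉F) →
  covers⁺ (w-perm , (λ where refl → w∉F (here refl)) , (λ where refl → w∉F (there (here refl))))
  where
  F = vtx u ∷ vtx v ∷ []
  vertex : ∀ {w} → Off u v w → VertexOf F w
  vertex (w-perm , w≢u , w≢v) = w-perm , λ where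
    (here refl)         → w≢u refl
    (there (here refl)) → w≢v refl
  noEdge : ∀ {x y} → edg x y ∉ F
  noEdge (there (there ()))
  open FromPartner {F = F} (λ w → isPerm? w ×-dec ¬? (w ≟ u) ×-dec ¬? (w ≟ v)) (partner M)
    (λ off → vertex off , vertex (closed M off) , adjacent M off , noEdge , noEdge)
    (closed M) (involutive M)

-- The target is `τ v` because a path from `u` to it frees `u` and `τ (τ v)`, which is `v`. A path
-- from `τ u` instead forces equal colours on `τ u` and `τ v`, hence on `u` and `v`.
perfect⊎sameSide : {u v : Arr (3 + m)} → IsPerm u → IsPerm v →
  HasPerfectMatching (vtx u ∷ vtx v ∷ []) ⊎ SameSide u v
perfect⊎sameSide {u = u} {v} u-perm v-perm =
  [ inj₁ ∘ matching , inj₂ ∘ sameSide ]′ (reaches τv-perm u u-perm)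
  where
  τu-perm = IsPerm-colour 0F u u-perm
  τv-perm = IsPerm-colour 0F v v-perm
  matching : Path (τ v) u → HasPerfectMatching (vtx u ∷ vtx v ∷ [])
  matching p = matchingOff⇒perfect (subst (MatchingOff u) (colour-involutive 0F v)
    (proj₁ (alternate τv-perm u-perm p)))
  sameSide : Path (τ v) (τ u) → SameSide u v
  sameSide p c proper = begin
    c u           ≡⟨ proper-adj c proper u-perm (colour-adj 0F u) ⟩
    not (c (τ u)) ≡⟨ cong not (proper-path c proper τu-perm p) ⟩
    not (c (τ v)) ≡⟨ sym (proper-adj c proper v-perm (colour-adj 0F v)) ⟩
    c v           ∎
    where open ≡-Reasoning

-- Deleting two vertices of equal parity

module Obstruction {u v : Arr (3 + m)} (u-perm : IsPerm u) (v-perm : IsPerm v) (u≢v : u ≢ v)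
  (pu≡pv : parity u ≡ parity v) where

  F : List (Elem (3 + m))
  F = vtx u ∷ vtx v ∷ []

  -- Perfect and almost-perfect matchings are refuted together: `w₀` is the one vertex allowed to
  -- stay uncovered.
  module _ (M : List (Arr (3 + m) × Arr (3 + m))) (isM : IsMatching F M) (w₀ : Arr (3 + m))
    (covered : ∀ w → VertexOf F w → w ≢ w₀ → Covers M w) where

    -- Parity is measured relative to u.
    Odd : Arr (3 + m) → Set
    Odd w = IsPerm w × parity w ≡ not (parity u)

    -- The index is kept because disjointness in `IsMatching` is stated for indices.
    Mate : Arr (3 + m) → Arr (3 + m) → Set
    Mate w z = ∃ λ i → List.lookup M i ≡ (w , z) ⊎ List.lookup M i ≡ (z , w)

    odd-τ : ∀ w → IsPerm w → parity w ≡ parity u → Odd (τ w)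
    odd-τ w w-perm pw = IsPerm-colour 0F w w-perm , trans (parity-τ w w-perm) (cong not pw)

    odd-vertex : ∀ {w} → Odd w → VertexOf F w
    odd-vertex (w-perm , pw) = w-perm , λ where
      (here refl)         → Bool.not-¬ refl pw
      (there (here refl)) → Bool.not-¬ (sym pu≡pv) pw

    mate : ∀ {w} → Odd w → w ≢ w₀ → ∃ (Mate w)
    mate {w} w-odd w≢w₀ with covered w (odd-vertex w-odd) w≢w₀
    ... | (a , b) , e∈M , inj₁ refl = b , Any.index e∈M , inj₁ (sym (lookup-index e∈M))
    ... | (a , b) , e∈M , inj₂ refl = a , Any.index e∈M , inj₂ (sym (lookup-index e∈M))

    mate-vertex : ∀ {w z} → Odd w → Mate w z → VertexOf F z × parity z ≡ parity u
    mate-vertex {w} {z} (w-perm , pw) (i , i≡) = help i≡ (proj₁ isM _ (∈-lookup i))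
      where
      even : Adj z w → parity z ≡ parity u
      even z∼w = trans (Adj-parity z w w-perm z∼w) (trans (cong not pw) (Bool.not-involutive _))
      help : ∀ {e} → e ≡ (w , z) ⊎ e ≡ (z , w) → EdgeOf F (proj₁ e) (proj₂ e) →
        VertexOf F z × parity z ≡ parity u
      help (inj₁ refl) (_ , z∈ , w∼z , _) = z∈ , even (Adj-sym {u = w} w∼z)
      help (inj₂ refl) (z∈ , _ , z∼w , _) = z∈ , even z∼w

    -- Distinct indices would give two matching edges at `z`; with equal indices only the
    -- orientation of one edge can vary.
    mate-injective : ∀ {w w′ z} → Mate w z → Mate w′ z → w ≡ w′
    mate-injective {w} {w′} {z} (i , i≡) (j , j≡) with i Fin.≟ j
    ... | no i≢j = contradiction (incident j≡) (proj₂ isM i j i≢j z (incident i≡))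
      where
      incident : ∀ {e x} → e ≡ (x , z) ⊎ e ≡ (z , x) → Incident z e
      incident (inj₁ refl) = inj₂ refl
      incident (inj₂ refl) = inj₁ refl
    ... | yes refl = same i≡ j≡
      where
      same : ∀ {e} → e ≡ (w , z) ⊎ e ≡ (z , w) → e ≡ (w′ , z) ⊎ e ≡ (z , w′) → w ≡ w′
      same (inj₁ refl) (inj₁ refl) = refl
      same (inj₁ refl) (inj₂ refl) = refl
      same (inj₂ refl) (inj₁ refl) = refl
      same (inj₂ refl) (inj₂ refl) = refl

    -- On odd vertices this is the graph of τ ∘ mate, completed by w₀ ↦ τ u; its range misses τ v.
    data Image (w x : Arr (3 + m)) : Set where
      fixed   : ¬ Odd w → x ≡ w → Image w x
      hole    : Odd w → w ≡ w₀ → x ≡ τ u → Image w x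
      matched : Odd w → ∀ z → Mate w z → x ≡ τ z → Image w x

    image : ∀ w → ∃ (Image w)
    image w with isPerm? w ×-dec (parity w Bool.≟ not (parity u)) | w ≟ w₀
    ... | no even | _       = w , fixed even refl
    ... | yes odd | yes hit = τ u , hole odd hit refl
    ... | yes odd | no miss with z , wz ← mate odd miss = τ z , matched odd z wz refl

    image-odd : ∀ {w x} → Odd w → Image w x → Odd x
    image-odd w-odd (fixed even _)       = contradiction w-odd even
    image-odd w-odd (hole _ _ refl)      = odd-τ u u-perm refl
    image-odd w-odd (matched _ z wz refl) with (z-perm , _) , pz ← mate-vertex w-odd wz = odd-τ z z-perm pz

    u-unmatched : ∀ {w} → Odd w → ¬ Mate w u
    u-unmatched w-odd wu = proj₂ (proj₁ (mate-vertex w-odd wu)) (here refl)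

    v-unmatched : ∀ {w} → Odd w → ¬ Mate w v
    v-unmatched w-odd wv = proj₂ (proj₁ (mate-vertex w-odd wv)) (there (here refl))

    -- Fixed arrangements are not odd, whereas the others have odd images. Among odd ones, `τ` is
    -- injective, mates determine each other, and the deleted `u` is nobody's mate.
    image-injective : ∀ {w w′ x} → Image w x → Image w′ x → w ≡ w′
    image-injective (fixed _ refl)    (fixed _ refl) = refl
    image-injective (fixed even refl) r@(hole odd′ _ _)      = contradiction (image-odd odd′ r) even
    image-injective (fixed even refl) r@(matched odd′ _ _ _) = contradiction (image-odd odd′ r) even
    image-injective r@(hole odd _ _)      (fixed even′ refl) = contradiction (image-odd odd r) even′
    image-injective r@(matched odd _ _ _) (fixed even′ refl) = contradiction (image-odd odd r) even′
    image-injective (hole _ refl _) (hole _ refl _) = refl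
    image-injective (hole _ _ eq) (matched odd′ z w′z eq′)
      with refl ← colour-injective 0F u z (trans (sym eq) eq′) = contradiction w′z (u-unmatched odd′)
    image-injective (matched odd z wz eq) (hole _ _ eq′)
      with refl ← colour-injective 0F u z (trans (sym eq′) eq) = contradiction wz (u-unmatched odd)
    image-injective (matched _ z wz eq) (matched _ z′ w′z′ eq′)
      with refl ← colour-injective 0F z z′ (trans (sym eq) eq′) = mate-injective wz w′z′

    -- As `τ v` is odd, it could only arise from `u ≡ v` or from a mate `v`, but `v` is deleted.
    image-misses : ∀ {w} → ¬ Image w (τ v)
    image-misses (fixed even refl) = even (odd-τ v v-perm (sym pu≡pv))
    image-misses (hole _ _ eq) = u≢v (colour-injective 0F u v (sym eq))
    image-misses (matched odd z wz eq) with refl ← colour-injective 0F v z eq = v-unmatched odd wz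

    impossible : ⊥
    impossible = injective⇒hits
      (λ {a} {b} eq → image-injective (proj₂ (image a)) (subst (Image b) (sym eq) (proj₂ (image b))))
      (τ v) (λ w eq → image-misses (subst (Image w) eq (proj₂ (image w))))

  isSMPSet : IsSMPSet F
  isSMPSet = valid ,
    -- A perfect matching leaves no exception, so any arrangement can serve as `w₀`; here it is `u`.
    (λ (M , isM , cov) → impossible M isM u λ w w∈ _ → cov w w∈) ,
    (λ (M , isM , w₀ , _ , _ , cov) → impossible M isM w₀ cov)
    where
    valid : AllValid F
    valid _ (here refl)         = u-perm
    valid _ (there (here refl)) = v-perm

-- Minimum size and optimal sets

sameParityPair : Σ (List (Elem (3 + m))) λ F → length F ≡ 2 × IsSMPSet F
sameParityPair {m} = vtx u ∷ vtx v ∷ [] , refl , Obstruction.isSMPSet u-perm v-perm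
  u≢v (sym (parity-rotate 0F u u-perm))
  where
  u v : Arr (3 + m)
  -- The identity and a 3-cycle of it: equal parity, but different first entries.
  u = Vec.allFin _
  v = rotate 0F u
  u-perm = IsPerm-allFin
  v-perm = IsPerm-rotate 0F u u-perm
  u≢v : u ≢ v
  u≢v ()

module _ {F : List (Elem (3 + m))} (|F|≤2 : length F ≤ 2) where

  noVertex⇒¬SMP : (∀ v → vtx v ∉ F) → ¬ IsSMPSet F
  noVertex⇒¬SMP noVertex (valid , ¬perfect , _) =
    let k , avoids = freeColour F |F|≤2 valid in ¬perfect (perfect k avoids noVertex)

  oneVertex⇒¬SMP : ∀ {v} → vtx v ∈ F → (∀ w → vtx w ∈ F → w ≡ v) → ¬ IsSMPSet F
  oneVertex⇒¬SMP v∈F only (valid , _ , ¬almost) =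
    let k , avoids = freeColour F |F|≤2 valid in ¬almost (almostPerfect k avoids (valid _ v∈F) v∈F only)

smallerThanTwo : (F : List (Elem (3 + m))) → length F < 2 → ¬ IsSMPSet F
smallerThanTwo []              _    = noVertex⇒¬SMP z≤n λ _ ()
smallerThanTwo (vtx _ ∷ [])    _    = oneVertex⇒¬SMP (s≤s z≤n) (here refl) λ where
  _ (here refl) → refl
  _ (there ())
smallerThanTwo (edg _ _ ∷ [])  _    = noVertex⇒¬SMP (s≤s z≤n) λ where
  _ (here ())
  _ (there ())
smallerThanTwo (_ ∷ _ ∷ _) (s≤s (s≤s ()))

optimal : (F : List (Elem (3 + m))) → length F ≡ 2 → IsSMPSet F →
  Σ (Arr (3 + m)) λ u → Σ (Arr (3 + m)) λ v → F ≡ vtx u ∷ vtx v ∷ [] × u ≢ v × SameSide u v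
optimal (edg _ _ ∷ edg _ _ ∷ []) _ smp = contradiction smp
  (noVertex⇒¬SMP ℕ.≤-refl λ where
    _ (here ())
    _ (there (here ()))
    _ (there (there ())))
optimal (vtx _ ∷ edg _ _ ∷ [])   _ smp = contradiction smp
  (oneVertex⇒¬SMP ℕ.≤-refl (here refl) λ where
    _ (here refl)  → refl
    _ (there (here ()))
    _ (there (there ())))
optimal (edg _ _ ∷ vtx _ ∷ [])   _ smp = contradiction smp
  (oneVertex⇒¬SMP ℕ.≤-refl (there (here refl)) λ where
    _ (here ())
    _ (there (here refl)) → refl
    _ (there (there ())))
optimal (vtx u ∷ vtx v ∷ [])     _ smp@(valid , ¬perfect , _) = u , v , refl , u≢v ,
  [ (λ pm → contradiction pm ¬perfect) , id ]′
    (perfect⊎sameSide (valid _ (here refl)) (valid _ (there (here refl))))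
  where
  u≢v : u ≢ v
  -- A repeated vertex makes the list a set with one deleted vertex, which leaves an almost-perfect
  -- matching.
  u≢v refl = oneVertex⇒¬SMP ℕ.≤-refl (here refl)
    (λ where _ (here refl)         → refl
             _ (there (here refl)) → refl
             _ (there (there ()))) smp

theorem2p7 : (n : ℕ) → 3 ≤ n →
    (Σ (List (Elem n)) λ F → length F ≡ 2 × IsSMPSet F)
    × ((F : List (Elem n)) → length F < 2 → ¬ IsSMPSet F)
    × ((F : List (Elem n)) → length F ≡ 2 → IsSMPSet F →
    Σ (Arr n) λ u → Σ (Arr n) λ v →
    F ≡ vtx u ∷ vtx v ∷ [] × u ≢ v × SameSide u v)
theorem2p7 (suc (suc (suc m))) (s≤s (s≤s (s≤s z≤n))) = sameParityPair , smallerThanTwo , optimal
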